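{- Let $\mathsf{L}$ and $\mathsf{K}$ be simplicial complexes. (1) The inequality $$\chi(\mathsf{L})\leq\chi(\mathsf{K})^{\mathrm{C}(\mathsf{L};\mathsf{K})}$$ holds. Equivalently, $\log_{\chi(\mathsf{K})}\chi(\mathsf{L})\leq \mathrm{C}(\mathsf{L};\mathsf{K})$. (2) Suppose that $\mathsf{K}$ has no isolated vertices. Then $$\mathrm{C}(G_{\mathsf{L}};G_{\mathsf{K}})\leq \mathrm{C}(\mathsf{L};\mathsf{K}).$$
   Context: A simplicial complex is an abstract simplicial complex: a set $\mathsf{K}$ of subsets (simplices) of a vertex set $V(\mathsf{K})=\bigcup\mathsf{K}$ such that $F\in\mathsf{K}$ and $G\subseteq F$ imply $G\in\mathsf{K}$. The dimension of a simplex $F$ is $|F|-1$. A facet is a simplex that is maximal with respect to inclusion; a facet is non-unitary if it has at least two vertices. A vertex is isolated if it lies in no simplex containing another vertex. A subcomplex of $\mathsf{K}$ is a simplicial complex contained in $\mathsf{K}$. The union of simplicial complexes is the union of their vertex sets and of their sets of simplices. A simplicial map $f:\mathsf{L}\to\mathsf{K}$ is a map $f:V(\mathsf{L})\to V(\mathsf{K})$ such that $f(F)\in\mathsf{K}$ whenever $F\in\mathsf{L}$. A facet simplicial map is a simplicial map $f:\mathsf{L}\to\mathsf{K}$ such that $f(F)$ is a non-unitary facet of $\mathsf{K}$ whenever $F$ is a non-unitary facet of $\mathsf{L}$. The facet-complexity $\mathrm{C}(\mathsf{L};\mathsf{K})$ is the least positive integer $k$ such that there exist subcomplexes $\mathsf{L}_1,\ldots,\mathsf{L}_k$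 of $\mathsf{L}$ with $\mathsf{L}=\mathsf{L}_1\cup\cdots\cup\mathsf{L}_k$ and, for each $i$, a facet simplicial map $f_i:\mathsf{L}_i\to\mathsf{K}$; it is $\infty$ if no such $k$ exists. In (1), the right-hand side is read as $\infty$ (so the inequality is trivially true) when $\mathrm{C}(\mathsf{L};\mathsf{K})=\infty$, and the logarithmic form is meant when $\chi(\mathsf{K})\geq 2$. The chromatic number $\chi(\mathsf{L})$ of a simplicial complex is the least $k$ such that the vertices of $\mathsf{L}$ can be colored with $k$ colors so that no non-unitary facet of $\mathsf{L}$ has all its vertices of the same color. For a simplicial complex $\mathsf{L}$, $G_{\mathsf{L}}$ denotes the graph whose edges are the facets of $\mathsf{L}$ of dimension $1$ and whose vertex set is the union of these edges. For graphs $G,H$, the hom-complexity $\mathrm{C}(G;H)$ is the least positive integer $k$ such that there exist subgraphs $G_1,\ldots,G_k$ of $G$ with $G=G_1\cup\cdots\cup G_k$ and, for each $i$, a graph homomorphism $G_i\to H$ (and $\infty$ if no such $k$ exists). -}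

module Defs where

open import Axiom.ExcludedMiddle using (ExcludedMiddle)
open import Data.Empty using (⊥)
open import Data.Fin.Base using (Fin)
open import Data.Nat.Base using (ℕ; zero; suc; _*_; _^_; _≤_; _<_)
open import Data.Nat.Induction using (<-wellFounded)
open import Data.Nat.Properties using (≰⇒>; _≤?_)
open import Data.Product.Base using (Σ-syntax; ∃; ∃₂; _×_; _,_; proj₁; proj₂)
open import Data.Sum.Base using (swap)
open import Data.Unit.Base using (⊤)
open import Function.Bundles using (Func)
open import Induction.WellFounded using (Acc; acc)
open import Level using (Level; Setω; _⊔_) renaming (suc to lsuc)
open import Relation.Binary.Bundles using (Setoid)
open import Relation.Binary.Core using (Rel)
import Relation.Binary.Construct.On as On
import Relation.Binary.Construct.Add.Supremum.NonStrict as Supremum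
open import Relation.Binary.PropositionalEquality.Core using (_≡_; _≢_; refl; sym)
open import Relation.Binary.PropositionalEquality.Properties using (setoid)
open import Relation.Nullary.Construct.Add.Supremum using (_⁺; ⊤⁺; [_])
open import Relation.Nullary.Decidable.Core using (yes; no; decidable-stable)
open import Relation.Nullary.Negation.Core using (¬_)
open import Relation.Unary using (Pred; _∈_; _⊆_; _≐_; _∪_; ｛_｝; ⋃)

private
  variable
    a b ℓ : Level

-- The ambient logic is classical: complexes and graphs are arbitrary (possibly
-- infinite), and numbers such as χ exist only by excluded middle.

EM : Setω
EM = ∀ {ℓ} → ExcludedMiddle ℓ

------------------------------------------------------------------------
-- Extended natural numbers, with ∞ = ⊤⁺

ℕ∞ : Set
ℕ∞ = ℕ ⁺

open Supremum _≤_ public using () renaming (_≤⁺_ to _≤∞_)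

-- ∞ as an exponent always gives ∞, even for the bases 0 and 1.

infixr 8 _^∞_

_^∞_ : ℕ∞ → ℕ∞ → ℕ∞
x     ^∞ ⊤⁺        = ⊤⁺
[ m ] ^∞ [ n ]     = [ m ^ n ]
⊤⁺    ^∞ [ zero ]  = [ 1 ]
⊤⁺    ^∞ [ suc n ] = ⊤⁺

-- log[ b ] x ≤ y  says that the real number log_b x is at most y, where b ≥ 2.
-- The logarithm is given by its lower Dedekind cut:  p / q ≤ log_b m  iff
-- b ^ p ≤ m ^ q  (for q > 0). As y ≥ 0, only nonnegative p / q matter; for m = 0
-- no p / q lies in the cut, in accordance with log_b 0 = -∞.

log[_]_≤_ : ℕ → ℕ∞ → ℕ∞ → Set
log[ b ] x     ≤ ⊤⁺    = ⊤
log[ b ] ⊤⁺    ≤ [ n ] = ⊥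
log[ b ] [ m ] ≤ [ n ] = ∀ p q → 0 < q → b ^ p ≤ m ^ q → p ≤ n * q

IsLeast : (ℕ → Set ℓ) → ℕ∞ → Set ℓ
IsLeast P [ k ] = P k × (∀ j → P j → k ≤ j)
IsLeast P ⊤⁺    = ∀ k → ¬ P k

least : EM → (P : ℕ → Set ℓ) → ∃ (IsLeast P)
least em P with em {P = ∃ P}
... | no ¬∃P       = ⊤⁺ , λ k Pk → ¬∃P (k , Pk)
... | yes (n , Pn) = descend n Pn (<-wellFounded n)
  where
  descend : ∀ k → P k → Acc _<_ k → ∃ (IsLeast P)
  descend k Pk (acc rs) with em {P = Σ[ j ∈ ℕ ] j < k × P j}
  ... | yes (j , j<k , Pj) = descend j Pj (rs j<k)
  ... | no ¬smaller        = [ k ] , Pk , λ j Pj →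
    decidable-stable (k ≤? j) λ k≰j → ¬smaller (j , ≰⇒> k≰j , Pj)

------------------------------------------------------------------------
-- Maps between vertex sets

-- A subset as a setoid: membership proofs are ignored, so that a function out of
-- it depends on the element only.

⟦_⟧ : {X : Set a} → Pred X b → Setoid (a ⊔ b) a
⟦_⟧ {X = X} P = On.setoid (setoid X) (proj₁ {B = P})

image : {X Y : Set ℓ} {P : Pred X ℓ} {Q : Pred Y ℓ} →
        Func ⟦ P ⟧ ⟦ Q ⟧ → Pred X ℓ → Pred Y ℓ
image f F y = ∃ λ x → proj₁ x ∈ F × proj₁ (Func.to f x) ≡ y

------------------------------------------------------------------------
-- Simplicial complexes

-- Neither X nor the simplices need be finite. Downward closure makes membership in
-- `simplices` invariant under _≐_.

record Complex (X : Set ℓ) : Set (lsuc ℓ) where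
  field
    V         : Pred X ℓ
    simplices : Pred (Pred X ℓ) ℓ
    V≐⋃       : V ≐ (λ v → ∃ λ F → F ∈ simplices × v ∈ F)
    closed    : ∀ {F G} → F ∈ simplices → G ⊆ F → G ∈ simplices

open Complex public

module _ {X : Set ℓ} where

  NonUnitary : Pred X ℓ → Set ℓ
  NonUnitary F = ∃₂ λ u v → u ∈ F × v ∈ F × u ≢ v

  IsFacet : Complex X → Pred X ℓ → Set (lsuc ℓ)
  IsFacet K F = F ∈ simplices K × (∀ {G} → G ∈ simplices K → F ⊆ G → G ⊆ F)

  IsNonUnitaryFacet : Complex X → Pred X ℓ → Set (lsuc ℓ)
  IsNonUnitaryFacet K F = IsFacet K F × NonUnitary F

  Isolated : Complex X → X → Set (lsuc ℓ)
  Isolated K v = v ∈ V K ×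
    (∀ F → F ∈ simplices K → v ∈ F → ¬ (∃ λ w → w ∈ F × w ≢ v))

  HasNoIsolatedVertices : Complex X → Set (lsuc ℓ)
  HasNoIsolatedVertices K = ∀ v → ¬ Isolated K v

  _≈ᶜ_ : Complex X → Complex X → Set (lsuc ℓ)
  K ≈ᶜ L = V K ≐ V L × simplices K ≐ simplices L

  -- Inclusion of vertex sets follows, by V≐⋃.

  _⊑ᶜ_ : Complex X → Complex X → Set (lsuc ℓ)
  K ⊑ᶜ L = simplices K ⊆ simplices L

  ⋃ᶜ : ∀ {k} → (Fin k → Complex X) → Complex X
  ⋃ᶜ {k} K = record
    { V         = ⋃ (Fin k) λ i → V (K i)
    ; simplices = ⋃ (Fin k) λ i → simplices (K i)
    ; V≐⋃       = (λ (i , v∈V) → let F , F∈K , v∈F = proj₁ (V≐⋃ (K i)) v∈V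
                                 in F , (i , F∈K) , v∈F)
                , (λ (F , (i , F∈K) , v∈F) → i , proj₂ (V≐⋃ (K i)) (F , F∈K , v∈F))
    ; closed    = λ (i , F∈K) G⊆F → i , closed (K i) F∈K G⊆F
    }

  IsProperColoring : (L : Complex X) {k : ℕ} →
                     Func ⟦ V L ⟧ (setoid (Fin k)) → Set (lsuc ℓ)
  IsProperColoring L c = ∀ F → IsNonUnitaryFacet L F →
    ¬ (∀ x y → proj₁ x ∈ F → proj₁ y ∈ F → Func.to c x ≡ Func.to c y)

  Colorable : Complex X → ℕ → Set (lsuc ℓ)
  Colorable L k = Σ[ c ∈ Func ⟦ V L ⟧ (setoid (Fin k)) ] IsProperColoring L c

  χ : EM → Complex X → ℕ∞
  χ em L = proj₁ (least em (Colorable L))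

module _ {X Y : Set ℓ} where

  IsSimplicial : (L : Complex X) (K : Complex Y) →
                 Func ⟦ V L ⟧ ⟦ V K ⟧ → Set (lsuc ℓ)
  IsSimplicial L K f = ∀ F → F ∈ simplices L → image f F ∈ simplices K

  IsFacetSimplicial : (L : Complex X) (K : Complex Y) →
                      Func ⟦ V L ⟧ ⟦ V K ⟧ → Set (lsuc ℓ)
  IsFacetSimplicial L K f = IsSimplicial L K f ×
    (∀ F → IsNonUnitaryFacet L F → IsNonUnitaryFacet K (image f F))

  FacetCover : Complex X → Complex Y → ℕ → Set (lsuc ℓ)
  FacetCover L K k = 0 < k × (Σ[ Lᵢ ∈ (Fin k → Complex X) ]
    (∀ i → Lᵢ i ⊑ᶜ L) ×
    L ≈ᶜ ⋃ᶜ Lᵢ ×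
    (∀ i → ∃ (IsFacetSimplicial (Lᵢ i) K)))

  facetComplexity : EM → Complex X → Complex Y → ℕ∞
  facetComplexity em L K = proj₁ (least em (FacetCover L K))

------------------------------------------------------------------------
-- Graphs

record Graph {a : Level} (X : Set a) (b : Level) : Set (a ⊔ lsuc b) where
  field
    Vᴳ     : Pred X b
    Adj    : Rel X b
    Adj⇒Vᴳ : ∀ {u v} → Adj u v → u ∈ Vᴳ
    symm   : ∀ {u v} → Adj u v → Adj v u
    irrefl : ∀ {v} → ¬ Adj v v

open Graph public

module _ {a b : Level} {X : Set a} where

  _⊑ᴳ_ : Graph X b → Graph X b → Set (a ⊔ b)
  G ⊑ᴳ H = Vᴳ G ⊆ Vᴳ H × (∀ u v → Adj G u v → Adj H u v)

  ⋃ᴳ : ∀ {k} → (Fin k → Graph X b) → Graph X b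
  ⋃ᴳ {k} G = record
    { Vᴳ     = ⋃ (Fin k) λ i → Vᴳ (G i)
    ; Adj    = λ u v → Σ[ i ∈ Fin k ] Adj (G i) u v
    ; Adj⇒Vᴳ = λ (i , uv) → i , Adj⇒Vᴳ (G i) uv
    ; symm   = λ (i , uv) → i , symm (G i) uv
    ; irrefl = λ (i , vv) → irrefl (G i) vv
    }

  _≈ᴳ_ : Graph X b → Graph X b → Set (a ⊔ b)
  G ≈ᴳ H = G ⊑ᴳ H × H ⊑ᴳ G

module _ {a b : Level} {X Y : Set a} where

  IsGraphHom : (G : Graph X b) (H : Graph Y b) →
               Func ⟦ Vᴳ G ⟧ ⟦ Vᴳ H ⟧ → Set (a ⊔ b)
  IsGraphHom G H f = ∀ x y → Adj G (proj₁ x) (proj₁ y) →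
    Adj H (proj₁ (Func.to f x)) (proj₁ (Func.to f y))

  HomCover : Graph X b → Graph Y b → ℕ → Set (a ⊔ lsuc b)
  HomCover G H k = 0 < k × (Σ[ Gᵢ ∈ (Fin k → Graph X b) ]
    (∀ i → Gᵢ i ⊑ᴳ G) ×
    G ≈ᴳ ⋃ᴳ Gᵢ ×
    (∀ i → ∃ (IsGraphHom (Gᵢ i) H)))

  homComplexity : EM → Graph X b → Graph Y b → ℕ∞
  homComplexity em G H = proj₁ (least em (HomCover G H))

-- The graph of one-dimensional facets: u and v are adjacent when u ≢ v and the
-- two-element set {u, v} is a facet.

module _ {X : Set ℓ} (L : Complex X) where

  private
    Edge : Rel X (lsuc ℓ)
    Edge u v = u ≢ v × IsFacet L (｛ u ｝ ∪ ｛ v ｝)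

    swap-⊆ : (u v : X) → (｛ u ｝ ∪ ｛ v ｝) ⊆ (｛ v ｝ ∪ ｛ u ｝)
    swap-⊆ u v = swap

    Edge-sym : ∀ {u v} → Edge u v → Edge v u
    Edge-sym {u} {v} (u≢v , uv∈L , maximal) =
      (λ v≡u → u≢v (sym v≡u)) ,
      closed L uv∈L (swap-⊆ v u) ,
      λ G∈L vu⊆G x∈G →
        swap-⊆ u v (maximal G∈L (λ x∈uv → vu⊆G (swap-⊆ u v x∈uv)) x∈G)

  facetGraph : Graph X (lsuc ℓ)
  facetGraph = record
    { Vᴳ     = λ v → ∃ λ w → Edge v w
    ; Adj    = Edge
    ; Adj⇒Vᴳ = λ {_} {v} uv → v , uv
    ; symm   = Edge-sym
    ; irrefl = λ (v≢v , _) → v≢v refl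
    }

{-# OPTIONS --safe #-}

-- Given a cover of L by subcomplexes Lᵢ with facet simplicial maps fᵢ : Lᵢ → K, a facet
-- of L that is a simplex of Lᵢ is a facet of Lᵢ. So if c is a proper coloring of K,
-- coloring v by the tuple of all c (fᵢ v) is proper for L: on a facet lying in Lᵢ the
-- i-th entry is not constant. Likewise the edges of the facet graph of L that lie in Lᵢ
-- form a subgraph which fᵢ maps into the facet graph of K.

module Submission where

open import Defs
open import Data.Empty using (⊥; ⊥-elim)
open import Data.Fin.Base using (Fin; zero; funToFin; finToFun)
open import Data.Fin.Properties using (finToFun-funToFin)
open import Data.Nat.Base using (ℕ; zero; suc; _*_; _^_; _≤_)
open import Data.Nat.Properties
  using (≤-trans; ≤-reflexive; ^-monoˡ-≤; ^-monoʳ-<; ^-*-assoc; ≰⇒>; <⇒≱; _≤?_)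
open import Data.Product.Base using (∃; _×_; _,_; proj₁; proj₂)
open import Data.Sum.Base using (inj₁; inj₂; swap)
open import Data.Unit.Base using (tt)
open import Function.Base using (_∘_)
open import Function.Bundles using (Func)
open import Level using (Level) renaming (suc to lsuc)
open import Relation.Binary.Construct.Add.Supremum.NonStrict _≤_ using ([_]; _≤⊤⁺)
open import Relation.Binary.PropositionalEquality.Core
  using (_≡_; _≢_; refl; sym; trans; cong; subst)
open import Relation.Binary.PropositionalEquality.Properties using (setoid)
open import Relation.Nullary.Construct.Add.Supremum using ([_]; ⊤⁺)
open import Relation.Nullary.Decidable.Core using (yes; no; decidable-stable)
open import Relation.Nullary.Negation.Core using (contradiction)
open import Relation.Unary using (Pred; _∈_; _⊆_; _≐_; _∪_; ｛_｝)

private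
  variable
    ℓ p q : Level

IsLeast⇒≤ : {P : ℕ → Set p} → ∀ x {n} → IsLeast P x → P n → x ≤∞ [ n ]
IsLeast⇒≤ [ k ] (_ , k≤) Pn = [ k≤ _ Pn ]
IsLeast⇒≤ ⊤⁺    ¬P       Pn = contradiction Pn (¬P _)

IsLeast-antimono : {P : ℕ → Set p} {Q : ℕ → Set q} → (∀ {k} → P k → Q k) →
                   ∀ x y → IsLeast P x → IsLeast Q y → y ≤∞ x
IsLeast-antimono P⇒Q [ k ] y (Pk , _) leastQ = IsLeast⇒≤ y leastQ (P⇒Q Pk)
IsLeast-antimono P⇒Q ⊤⁺    y _        _      = y ≤⊤⁺

-- If n * q < p, then b^(n q) < b^p ≤ m^q ≤ (b^n)^q = b^(n q), a contradiction; the first step is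
-- strict because `2 ≤ b`.
≤^∞⇒log≤ : ∀ b x y → 2 ≤ b → x ≤∞ [ b ] ^∞ y → log[ b ] x ≤ y
≤^∞⇒log≤ b x     ⊤⁺    2≤b x≤b^y = tt
≤^∞⇒log≤ b [ m ] [ n ] 2≤b [ m≤b^n ] p q _ b^p≤m^q =
  decidable-stable (p ≤? n * q) λ p≰nq →
    <⇒≱ (^-monoʳ-< b 2≤b (≰⇒> p≰nq))
        (≤-trans b^p≤m^q (≤-trans (^-monoˡ-≤ q m≤b^n) (≤-reflexive (^-*-assoc b n q))))

module _ {X : Set ℓ} where

  -- Every simplex of `M` above `F` is also a simplex of `L`, so maximality in `L` applies to it.
  IsFacet-⊑ : {M L : Complex X} {F : Pred X ℓ} →
              M ⊑ᶜ L → F ∈ simplices M → IsFacet L F → IsFacet M F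
  IsFacet-⊑ M⊑L F∈M (_ , maximal) = F∈M , λ G∈M → maximal (M⊑L G∈M)

  IsFacet-resp-≐ : (K : Complex X) {F G : Pred X ℓ} → F ≐ G → IsFacet K F → IsFacet K G
  IsFacet-resp-≐ K (F⊆G , G⊆F) (F∈K , maximal) =
    closed K F∈K G⊆F , λ H∈K G⊆H x∈H → F⊆G (maximal H∈K (λ x∈F → G⊆H (F⊆G x∈F)) x∈H)

  -- The facet graph of `M` would not do: a two-element facet of `M` may sit properly inside a
  -- larger simplex of `L`, and then it is no edge of `facetGraph L`.
  edgesIn : Complex X → Complex X → Graph X (lsuc ℓ)
  edgesIn L M = record
    { Vᴳ     = λ v → ∃ λ w → E v w
    ; Adj    = E
    ; Adj⇒Vᴳ = λ {_} {v} uv → v , uv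
    ; symm   = λ (uv , uv∈M) → symm (facetGraph L) uv , closed M uv∈M swap
    ; irrefl = λ (vv , _) → irrefl (facetGraph L) vv
    }
    where
    E : X → X → Set (lsuc ℓ)
    E u v = Adj (facetGraph L) u v × (｛ u ｝ ∪ ｛ v ｝) ∈ simplices M

module _ {X Y : Set ℓ} {P : Pred X ℓ} {Q : Pred Y ℓ} (f : Func ⟦ P ⟧ ⟦ Q ⟧) where

  private
    f₁ : ∃ P → Y
    f₁ x = proj₁ (Func.to f x)

  image-pair : ∀ x y → image f (｛ proj₁ x ｝ ∪ ｛ proj₁ y ｝) ≐ (｛ f₁ x ｝ ∪ ｛ f₁ y ｝)
  image-pair x y =
      (λ { (_ , inj₁ x≡z , refl) → inj₁ (Func.cong f x≡z)
         ; (_ , inj₂ y≡z , refl) → inj₂ (Func.cong f y≡z) })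
    , (λ { (inj₁ refl) → x , inj₁ refl , refl
         ; (inj₂ refl) → y , inj₂ refl , refl })

-- Rules out that an edge is collapsed: with `u ≡ v` all elements of `F` would coincide.
NonUnitary-pair : {X : Set ℓ} {F : Pred X ℓ} {u v : X} →
                  F ⊆ (｛ u ｝ ∪ ｛ v ｝) → NonUnitary F → u ≢ v
NonUnitary-pair F⊆uv (a , b , a∈F , b∈F , a≢b) refl =
  a≢b (trans (sym (collapse (F⊆uv a∈F))) (collapse (F⊆uv b∈F)))
  where
  collapse : ∀ {u x} → x ∈ (｛ u ｝ ∪ ｛ u ｝) → u ≡ x
  collapse (inj₁ u≡x) = u≡x
  collapse (inj₂ u≡x) = u≡x

module _ (em : EM) {X : Set ℓ} {A : Set} {P : Pred X ℓ} (d : A) (g : Func ⟦ P ⟧ (setoid A)) where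

  -- A vertex of `L` need not lie in every subcomplex of the cover, yet its color tuple needs an
  -- entry for each of them; `d` fills the gaps.
  extend : X → A
  extend v with em {P = P v}
  ... | yes v∈P = Func.to g (v , v∈P)
  ... | no  _   = d

  extend-∈ : ∀ x → extend (proj₁ x) ≡ Func.to g x
  extend-∈ (v , v∈P) with em {P = P v}
  -- The membership proof found by `em` may differ from the given one, but `g` respects equality of
  -- the underlying elements.
  ... | yes _   = Func.cong g refl
  ... | no  v∉P = contradiction v∈P v∉P

module _ {X Y : Set ℓ} (L : Complex X) (K : Complex Y) where

  -- An edge {u, v} is a non-unitary facet of `M`, so its image {f u, f v} is a non-unitary facet of
  -- `K`: its two ends are distinct and it is an edge of `facetGraph K`.
  edgesIn-hom : {M : Complex X} → M ⊑ᶜ L → ∃ (IsFacetSimplicial M K) →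
                ∃ (IsGraphHom (edgesIn L M) (facetGraph K))
  edgesIn-hom {M} M⊑L (f , _ , facet) = g , λ x y xy → edge (vertex x) (vertex y) xy
    where
    G : Graph X (lsuc ℓ)
    G = edgesIn L M

    vertex : ∃ (Vᴳ G) → ∃ (V M)
    vertex (u , _ , _ , uv∈M) = u , proj₂ (V≐⋃ M) (_ , uv∈M , inj₁ refl)

    edge : ∀ x y → Adj G (proj₁ x) (proj₁ y) →
           Adj (facetGraph K) (proj₁ (Func.to f x)) (proj₁ (Func.to f y))
    edge x y ((x≢y , xy-facet) , xy∈M) =
      let fxy-facet , fxy-nonUnitary =
            facet _ (IsFacet-⊑ {M = M} {L = L} M⊑L xy∈M xy-facet ,
                     _ , _ , inj₁ refl , inj₂ refl , x≢y)
      in NonUnitary-pair (proj₁ (image-pair f x y)) fxy-nonUnitary ,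
         IsFacet-resp-≐ K (image-pair f x y) fxy-facet

    -- A vertex of `facetGraph K` must come with a neighbor; the image of the neighbor `w` of `v`
    -- serves.
    g : Func ⟦ Vᴳ G ⟧ ⟦ Vᴳ (facetGraph K) ⟧
    g = record
      { to   = λ x@(v , w , vw) → proj₁ (Func.to f (vertex x)) , _ ,
               edge (vertex x) (vertex (w , v , symm G vw)) vw
      ; cong = λ x≡y → Func.cong f x≡y
      }

  FacetCover⇒HomCover : ∀ {k} → FacetCover L K k → HomCover (facetGraph L) (facetGraph K) k
  FacetCover⇒HomCover (0<k , M , M⊑L , (_ , L⊆⋃M , _) , f) =
    0<k , (λ i → edgesIn L (M i)) ,
    (λ i → (λ (w , vw , _) → w , vw) , λ _ _ → proj₁) ,
    ( ( (λ (w , vw) → let i , vw∈M = L⊆⋃M (proj₁ (proj₂ vw)) in i , w , vw , vw∈M)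
      , (λ _ _ uv → let i , uv∈M = L⊆⋃M (proj₁ (proj₂ uv)) in i , uv , uv∈M))
    , ( (λ (_ , w , vw , _) → w , vw)
      , (λ _ _ (_ , uv , _) → uv))) ,
    λ i → edgesIn-hom {M i} (M⊑L i) (f i)

  module _ (em : EM) where

    Colorable-cover : ∀ {k m} → FacetCover L K k → Colorable K m → Colorable L (m ^ k)
    -- Without colors K has no vertices, so neither has L.
    Colorable-cover {m = zero} (_ , _ , _ , ((V⊆ , _) , _) , f) (c , _) =
      record { to = λ x → ⊥-elim (empty x) ; cong = λ {x} _ → ⊥-elim (empty x) } ,
      λ F ((F∈L , _) , u , _ , u∈F , _) _ →
        empty (u , proj₂ (V≐⋃ L) (F , F∈L , u∈F))
      where
      empty : ∃ (V L) → ⊥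
      empty (v , v∈L) with V⊆ v∈L
      ... | i , v∈M with Func.to c (Func.to (proj₁ (f i)) (v , v∈M))
      ... | ()
    Colorable-cover {k} {suc m} (_ , M , M⊑L , (_ , L⊆⋃M , _) , f) (c , proper) =
      record { to = color ∘ proj₁ ; cong = cong color } , color-proper
      where
      cᵢ : ∀ i → Func ⟦ V (M i) ⟧ (setoid (Fin (suc m)))
      cᵢ i = record
        { to   = λ x → Func.to c (Func.to (proj₁ (f i)) x)
        ; cong = λ x≡y → Func.cong c (Func.cong (proj₁ (f i)) x≡y)
        }

      -- The default color `zero` is arbitrary; properness on a facet is checked only at an index
      -- `i` whose `M i` contains that facet, where the entry is the value of `cᵢ i`.
      tuple : X → Fin k → Fin (suc m)
      tuple v i = extend em zero (cᵢ i) v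

      color : X → Fin (suc m ^ k)
      color v = funToFin (tuple v)

      color-injective : ∀ i {x y} → color (proj₁ x) ≡ color (proj₁ y) →
                        Func.to (cᵢ i) x ≡ Func.to (cᵢ i) y
      color-injective i {x} {y} eq =
        trans (sym (entry x)) (trans (cong (λ t → finToFun t i) eq) (entry y))
        where
        entry : ∀ z → finToFun (color (proj₁ z)) i ≡ Func.to (cᵢ i) z
        entry z = trans (finToFun-funToFin (tuple (proj₁ z)) i) (extend-∈ em zero (cᵢ i) z)

      color-proper : IsProperColoring L record { to = color ∘ proj₁ ; cong = cong color }
      color-proper F (F-facet , F-nonUnitary) mono with L⊆⋃M (proj₁ F-facet)
      ... | i , F∈M = proper (image (proj₁ (f i)) F)
        (proj₂ (proj₂ (f i)) F
          (IsFacet-⊑ {M = M i} {L = L} (M⊑L i) F∈M F-facet , F-nonUnitary))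
        -- If `F` had a single color, the i-th entries would agree on `F`, so `c` would be constant
        -- on the image of `F`, a non-unitary facet of `K`.
        λ { x y (x′ , x′∈F , fx′≡x) (y′ , y′∈F , fy′≡y) →
            trans (sym (Func.cong c fx′≡x))
              (trans (color-injective i {x′} {y′}
                       (mono (inL x′∈F) (inL y′∈F) x′∈F y′∈F))
                (Func.cong c fy′≡y)) }
        where
        inL : ∀ {v} → v ∈ F → ∃ (V L)
        inL v∈F = _ , proj₂ (V≐⋃ L) (F , proj₁ F-facet , v∈F)

    χ-bound : ∀ x y z → IsLeast (Colorable L) x → IsLeast (Colorable K) y →
              IsLeast (FacetCover L K) z → x ≤∞ y ^∞ z
    χ-bound x y     ⊤⁺          _  _         _          = x ≤⊤⁺
    χ-bound x ⊤⁺    [ suc _ ]   _  _         _          = x ≤⊤⁺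
    -- Here the bound would be `[ 1 ]` rather than `⊤⁺`, but a cover has a positive number of
    -- members.
    χ-bound x ⊤⁺    [ zero ]    _  _         ((() , _) , _)
    χ-bound x [ m ] [ k ]       lx (col , _) (cover , _) =
      IsLeast⇒≤ x lx (Colorable-cover cover col)

theorem3p14 : ∀ (em : EM) {ℓ} {X Y : Set ℓ} (L : Complex X) (K : Complex Y) →
    (χ em L ≤∞ χ em K ^∞ facetComplexity em L K ×
    (∀ b → χ em K ≡ [ b ] → 2 ≤ b → log[ b ] χ em L ≤ facetComplexity em L K)) ×
    (HasNoIsolatedVertices K →
    homComplexity em (facetGraph L) (facetGraph K) ≤∞ facetComplexity em L K)
theorem3p14 em L K =
  (χL≤ , λ b χK≡b 2≤b →
    ≤^∞⇒log≤ b (χ em L) C 2≤b (subst (λ y → χ em L ≤∞ y ^∞ C) χK≡b χL≤)) ,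
  λ _ → IsLeast-antimono (FacetCover⇒HomCover L K) C _
          (proj₂ (least em (FacetCover L K)))
          (proj₂ (least em (HomCover (facetGraph L) (facetGraph K))))
  where
  C : ℕ∞
  C = facetComplexity em L K

  χL≤ : χ em L ≤∞ χ em K ^∞ C
  χL≤ = χ-bound L K em (χ em L) (χ em K) C (proj₂ (least em (Colorable L)))
          (proj₂ (least em (Colorable K))) (proj₂ (least em (FacetCover L K)))
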